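{- There exist $X\in 2^{\mathbb{N}}$ that are weakly random and whose digits are not normal.
   Context: $2^{\mathbb{N}}$ is the Cantor space of all total functions $X:\mathbb{N}\to\{0,1\}$ (infinite binary sequences, indexed from $0$). For a finite bitstring $\sigma$, $N_\sigma$ is the set of $X\in 2^{\mathbb{N}}$ having $\sigma$ as an initial segment, and $\mu$ is the unique Borel measure on $2^{\mathbb{N}}$ with $\mu(N_\sigma)=2^{ -|\sigma|}$ for every bitstring $\sigma$. A set $A\subseteq 2^{\mathbb{N}}$ is $\Pi^0_1$ if there is a recursive predicate $R$ such that $X\in A$ if and only if $R(X,n)$ holds for all $n\in\mathbb{N}$. Equivalently, the $\Pi^0_1$ sets are exactly the sets $U_e=\{X\in 2^{\mathbb{N}}:\varphi_e^X(0)\uparrow\}$, $e\in\mathbb{N}$, where $\varphi_e^X(x)$ is the output (if it halts) of the program with Gödel number $e$ on input $x$ with oracle $X$, and $\uparrow$ means "is undefined". A point $X\in 2^{\mathbb{N}}$ is weakly random if it does not belong to any $\Pi^0_1$ set of $\mu$-measure $0$. $X\in 2^{\mathbb{N}}$ is normal if for every $l$ and every $\sigma\in\{0,1\}^l$, the fraction of indices $i<n$ such that $\langle X(i),X(i+1),\dots,X(i+l-1)\rangle=\sigma$ tends to $\frac{1}{2^l}$ as $n\to\infty$. -}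

module Defs where

open import Data.Bool using (Bool; if_then_else_)
import Data.Bool.Properties as Bool
open import Data.Fin using (Fin)
open import Data.Integer using (+_; 1ℤ)
open import Data.List using (List; length; applyUpTo; upTo; filter; foldr)
open import Data.List.Properties using (≡-dec)
open import Data.Nat using (ℕ; zero; suc; _^_; NonZero)
import Data.Nat as ℕ
open import Data.Nat.Properties using (m^n≢0)
open import Data.Product using (Σ-syntax; ∃-syntax; _×_)
open import Data.Rational using (ℚ; 0ℚ; _/_; _+_; _-_; ∣_∣; _≤_; _<_)
open import Data.Sum using (_⊎_)
open import Data.Vec using (Vec; []; _∷_; lookup)
open import Function using (_⇔_; _∘_)
open import Level using (0ℓ)
open import Relation.Binary.Definitions using (DecidableEquality)
open import Relation.Binary.PropositionalEquality using (_≡_)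
open import Relation.Nullary using (¬_)
open import Relation.Unary using (Pred; _⊆_; _∈_; _∉_; ⋃)

------------------------------------------------------------------------
-- Cantor space

-- The digit 1 is true, the digit 0 is false.
Cantor : Set
Cantor = ℕ → Bool

Bitstring : Set
Bitstring = List Bool

_≟ᵇ_ : DecidableEquality Bitstring
_≟ᵇ_ = ≡-dec Bool._≟_

-- ⟨ X i , X (i + 1) , … , X (i + l - 1) ⟩
block : Cantor → ℕ → ℕ → Bitstring
block X i l = applyUpTo (λ j → X (i ℕ.+ j)) l

N : Bitstring → Pred Cantor 0ℓ
N σ X = block X 0 (length σ) ≡ σ

------------------------------------------------------------------------
-- Measure

2^-_ : ℕ → ℚ
2^- l = _/_ 1ℤ (2 ^ l) {{m^n≢0 2 l}}

partialSum : (ℕ → ℚ) → ℕ → ℚ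
partialSum a n = foldr _+_ 0ℚ (applyUpTo a n)

-- The Borel measure with μ(N_σ) = 2^-|σ| is given by its Carathéodory
-- extension, μ(A) = inf { Σᵢ 2^-|σᵢ| : A ⊆ ⋃ᵢ N_σᵢ }.  As real numbers are
-- not available, this infimum is represented by its upper cut: A μ< q
-- says that some such series has a sum below q.  The rational r bounding
-- the partial sums makes the inequality "sum < q" strict.
_μ<_ : Pred Cantor 0ℓ → ℚ → Set
A μ< q =
  Σ[ σ ∈ (ℕ → Bitstring) ]
    (A ⊆ ⋃ ℕ (N ∘ σ)) ×
    (∃[ r ] (r < q × (∀ n → partialSum (λ i → 2^- length (σ i)) n ≤ r)))

-- μ(A) = r, as an equality of upper cuts.
HasMeasure : Pred Cantor 0ℓ → ℚ → Set
HasMeasure A r = ∀ q → (A μ< q) ⇔ (r < q)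

------------------------------------------------------------------------
-- Computation with an oracle

-- Programs for the k-ary partial recursive functions with an oracle.
data Program : ℕ → Set where
  zero   : Program 0
  succ   : Program 1
  oracle : Program 1
  proj   : ∀ {k} → Fin k → Program k
  comp   : ∀ {k m} → Program m → Vec (Program k) m → Program k
  prec   : ∀ {k} → Program k → Program (2 ℕ.+ k) → Program (suc k)
  mu     : ∀ {k} → Program (suc k) → Program k

infix 4 _⊢_⟨_⟩⇓_

-- X ⊢ f ⟨ xs ⟩⇓ y : with oracle X and input xs, f halts with output y.
data _⊢_⟨_⟩⇓_ (X : Cantor) : ∀ {k} → Program k → Vec ℕ k → ℕ → Set where
  ⇓zero   : X ⊢ zero ⟨ [] ⟩⇓ 0
  ⇓succ   : ∀ {n} → X ⊢ succ ⟨ n ∷ [] ⟩⇓ suc n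
  ⇓oracle : ∀ {n} → X ⊢ oracle ⟨ n ∷ [] ⟩⇓ (if X n then 1 else 0)
  ⇓proj   : ∀ {k} {i : Fin k} {xs} → X ⊢ proj i ⟨ xs ⟩⇓ lookup xs i
  ⇓comp   : ∀ {k m} {f : Program m} {gs : Vec (Program k) m} {xs ys z} →
            (∀ i → X ⊢ lookup gs i ⟨ xs ⟩⇓ lookup ys i) →
            X ⊢ f ⟨ ys ⟩⇓ z →
            X ⊢ comp f gs ⟨ xs ⟩⇓ z
  ⇓prec0  : ∀ {k} {f : Program k} {g xs y} →
            X ⊢ f ⟨ xs ⟩⇓ y →
            X ⊢ prec f g ⟨ 0 ∷ xs ⟩⇓ y
  ⇓prec+  : ∀ {k} {f : Program k} {g n xs y z} →
            X ⊢ prec f g ⟨ n ∷ xs ⟩⇓ y →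
            X ⊢ g ⟨ n ∷ y ∷ xs ⟩⇓ z →
            X ⊢ prec f g ⟨ suc n ∷ xs ⟩⇓ z
  ⇓mu     : ∀ {k} {f : Program (suc k)} {xs y} →
            X ⊢ f ⟨ y ∷ xs ⟩⇓ 0 →
            (∀ z → z ℕ.< y → ∃[ v ] X ⊢ f ⟨ z ∷ xs ⟩⇓ suc v) →
            X ⊢ mu f ⟨ xs ⟩⇓ y

-- A predicate on 2^ℕ × ℕ is recursive if a single program, using X as its
-- oracle, halts on every (X , n) and computes the characteristic function.
Recursive : (Cantor → Pred ℕ 0ℓ) → Set
Recursive R =
  Σ[ f ∈ Program 1 ] ∀ X n →
    (R X n × X ⊢ f ⟨ n ∷ [] ⟩⇓ 1) ⊎ (¬ R X n × X ⊢ f ⟨ n ∷ [] ⟩⇓ 0)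

Π⁰₁ : Pred Cantor 0ℓ → Set₁
Π⁰₁ A = Σ[ R ∈ (Cantor → Pred ℕ 0ℓ) ]
  Recursive R × (∀ X → X ∈ A ⇔ (∀ n → R X n))

WeaklyRandom : Cantor → Set₁
WeaklyRandom X = ∀ (A : Pred Cantor 0ℓ) → Π⁰₁ A → HasMeasure A 0ℚ → X ∉ A

------------------------------------------------------------------------
-- Normality

occurrences : Cantor → Bitstring → ℕ → ℕ
occurrences X σ n = length (filter (λ i → block X i (length σ) ≟ᵇ σ) (upTo n))

frequency : Cantor → Bitstring → (n : ℕ) .{{_ : NonZero n}} → ℚ
frequency X σ n = + occurrences X σ n / n

Normal : Cantor → Set
Normal X = ∀ (σ : Bitstring) (ε : ℚ) → 0ℚ < ε →
  ∃[ n₀ ] (∀ n .{{_ : NonZero n}} → n₀ ℕ.≤ n →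
    ∣ frequency X σ n - 2^- length σ ∣ < ε)

{-# OPTIONS --safe #-}

-- X is built by finite extension.  A Π⁰₁ set A of measure 0 contains no
-- cylinder, because a cover of total weight below 2^-m misses a point of any
-- cylinder N_τ with |τ| = m: reading the digits of that point one at a time,
-- some digit keeps the conditional weight of the cover below 1.  So inside N_τ
-- there is a Z at which the program deciding A answers 0; by the use principle
-- it does so on a whole neighbourhood of Z, and N_τ can be shrunk to avoid A.
-- Each stage does this for finitely many programs, every program being treated
-- at some stage, and first pads the initial segment of length m with zeros to
-- length 4m + 1, so that the frequency of the digit 1 is at most 1/4
-- infinitely often.
module Submission where

open import Defs
open import Axiom.ExcludedMiddle using (ExcludedMiddle)
open import Data.Product using (Σ-syntax; _×_)
open import Level using (0ℓ)
open import Relation.Nullary using (¬_)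

open import Algebra.Bundles using (CommutativeMonoid)
open import Algebra.Properties.CommutativeSemigroup using (interchange)
open import Data.Bool using (Bool; true; false; if_then_else_)
open import Data.Empty using (⊥)
open import Data.Fin using (Fin; zero; suc)
open import Data.Integer using (+_; 1ℤ)
import Data.Integer as ℤ
import Data.Integer.Properties as ℤ
open import Data.List
  using (List; []; _∷_; _++_; [_]; length; map; filter; concatMap; cartesianProductWith;
         allFin; upTo)
open import Data.List.Membership.Propositional using (_∈_; lose)
open import Data.List.Membership.Propositional.Properties
  using (∈-map⁺; ∈-++⁺ˡ; ∈-++⁺ʳ; ∈-concatMap⁺; ∈-cartesianProductWith⁺; ∈-upTo⁺; ∈-allFin)
open import Data.List.Properties
  using (∷-injective; upTo-∷ʳ; filter-++; filter-reject; length-filter; length-upTo;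
         ++-identityʳ)
open import Data.List.Relation.Unary.Any using (here; there)
open import Data.Maybe using (Maybe; just; nothing)
open import Data.Nat using (ℕ; zero; suc; s≤s; z≤n; _⊔_; _^_; NonZero; _≤′_; ≤′-refl; ≤′-step)
import Data.Nat as ℕ
import Data.Nat.Properties as ℕ
open import Data.Nat.Tactic.RingSolver using (solve-∀)
open import Data.Product using (_,_; proj₁; proj₂; ∃-syntax)
open import Data.Rational using (ℚ; 0ℚ; 1ℚ; ½; _/_; _+_; _-_; -_; ∣_∣; _≤_; _<_; fromℚᵘ; toℚᵘ)
import Data.Rational.Properties as ℚ
open import Data.Rational.Unnormalised using (mkℚᵘ; *≡*; *≤*)
import Data.Rational.Unnormalised as ℚᵘ
import Data.Rational.Unnormalised.Properties as ℚᵘ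
open import Data.Sum using (inj₁; inj₂)
open import Data.Vec using (Vec; []; _∷_; lookup)
open import Data.Vec.Properties using (tabulate∘lookup; tabulate-cong)
open import Function using (_∘_; Equivalence)
open import Relation.Binary.Definitions using (tri<; tri≈; tri>)
open import Relation.Binary.PropositionalEquality
  using (_≡_; _≢_; refl; sym; trans; cong; cong₂; subst; subst₂; module ≡-Reasoning)
open import Relation.Nullary using (yes; no; does; contradiction)
open import Relation.Nullary.Decidable using (dec-true; dec-false)
open import Relation.Unary using (Pred)

-- Properties of all sufficiently large numbers

-- Asking for every `e` above the bound, rather than for one, lets finitely many such properties be
-- combined by taking the maximum of their bounds.
Eventually : Pred ℕ 0ℓ → Set
Eventually P = ∃[ d ] (∀ e → d ℕ.≤ e → P e)

eventually-× : ∀ {P Q} → Eventually P → Eventually Q → Eventually (λ d → P d × Q d)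
eventually-× (a , p) (b , q) = a ⊔ b , λ e a⊔b≤e →
  p e (ℕ.m⊔n≤o⇒m≤o a b a⊔b≤e) , q e (ℕ.m⊔n≤o⇒n≤o a b a⊔b≤e)

eventually-map : ∀ {P Q : Pred ℕ 0ℓ} → (∀ d → P d → Q d) → Eventually P → Eventually Q
eventually-map f (a , p) = a , λ e a≤e → f e (p e a≤e)

eventually-suc : ∀ {P} → Eventually (P ∘ suc) → Eventually P
eventually-suc (a , p) = suc a , λ where (suc e) (s≤s a≤e) → p e a≤e

eventually-∀Fin : ∀ {n} {P : Fin n → Pred ℕ 0ℓ} →
  (∀ i → Eventually (P i)) → Eventually (λ d → ∀ i → P i d)
eventually-∀Fin {zero}  h = 0 , λ _ _ ()
eventually-∀Fin {suc n} h = eventually-map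
  (λ { d (p , ps) zero → p ; d (p , ps) (suc i) → ps i })
  (eventually-× (h zero) (eventually-∀Fin (h ∘ suc)))

eventually-∀< : ∀ n {P : ∀ i → i ℕ.< n → Pred ℕ 0ℓ} →
  (∀ i i<n → Eventually (P i i<n)) → Eventually (λ d → ∀ i i<n → P i i<n d)
eventually-∀< zero    h = 0 , λ _ _ _ ()
eventually-∀< (suc n) h = eventually-map
  (λ { d (p , ps) zero (s≤s z≤n) → p ; d (p , ps) (suc i) (s≤s i<n) → ps i i<n })
  (eventually-× (h 0 (s≤s z≤n)) (eventually-∀< n (λ i i<n → h (suc i) (s≤s i<n))))

-- Computations

infix 4 _≈[_]_

_≈[_]_ : Cantor → ℕ → Cantor → Set
X ≈[ m ] Y = ∀ i → i ℕ.< m → X i ≡ Y i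

-- The use principle: a derivation has finitely many premises at each node, also under `⇓mu`, so it
-- queries only finitely many digits of the oracle.
use : ∀ {X k} {f : Program k} {xs y} → X ⊢ f ⟨ xs ⟩⇓ y →
  Eventually (λ m → ∀ Y → X ≈[ m ] Y → Y ⊢ f ⟨ xs ⟩⇓ y)
use ⇓zero = 0 , λ _ _ _ _ → ⇓zero
use ⇓succ = 0 , λ _ _ _ _ → ⇓succ
use (⇓oracle {n}) = suc n , λ e n<e Y X≈Y →
  subst (λ b → Y ⊢ oracle ⟨ n ∷ [] ⟩⇓ (if b then 1 else 0)) (sym (X≈Y n n<e)) ⇓oracle
use ⇓proj = 0 , λ _ _ _ _ → ⇓proj
use (⇓comp gs f) = eventually-map
  (λ _ (gs′ , f′) Y X≈Y → ⇓comp (λ i → gs′ i Y X≈Y) (f′ Y X≈Y))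
  (eventually-× (eventually-∀Fin (λ i → use (gs i))) (use f))
use (⇓prec0 f) = eventually-map (λ _ f′ Y X≈Y → ⇓prec0 (f′ Y X≈Y)) (use f)
use (⇓prec+ r g) = eventually-map
  (λ _ (r′ , g′) Y X≈Y → ⇓prec+ (r′ Y X≈Y) (g′ Y X≈Y))
  (eventually-× (use r) (use g))
use (⇓mu {y = y} f below) = eventually-map
  (λ _ (f′ , below′) Y X≈Y →
    ⇓mu (f′ Y X≈Y) (λ z z<y → proj₁ (below z z<y) , below′ z z<y Y X≈Y))
  (eventually-× (use f) (eventually-∀< y (λ z z<y → use (proj₂ (below z z<y)))))

-- The rule `⇓comp` fixes the intermediate values only entry by entry; determinism has to identify
-- the two vectors.
lookup-injective : ∀ {n} {xs ys : Vec ℕ n} → (∀ i → lookup xs i ≡ lookup ys i) → xs ≡ ys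
lookup-injective {xs = xs} {ys} eq =
  trans (sym (tabulate∘lookup xs)) (trans (tabulate-cong eq) (tabulate∘lookup ys))

deterministic : ∀ {X k} {f : Program k} {xs y z} →
  X ⊢ f ⟨ xs ⟩⇓ y → X ⊢ f ⟨ xs ⟩⇓ z → y ≡ z
deterministic ⇓zero   ⇓zero   = refl
deterministic ⇓succ   ⇓succ   = refl
deterministic ⇓oracle ⇓oracle = refl
deterministic ⇓proj   ⇓proj   = refl
deterministic (⇓comp {ys = ys} gs f) (⇓comp {ys = ys′} gs′ f′)
  with refl ← lookup-injective {xs = ys} {ys′} (λ i → deterministic (gs i) (gs′ i)) = deterministic f f′
deterministic (⇓prec0 f) (⇓prec0 f′) = deterministic f f′
deterministic (⇓prec+ r g) (⇓prec+ r′ g′)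
  with refl ← deterministic r r′ = deterministic g g′
deterministic (⇓mu {y = y} f below) (⇓mu {y = z} f′ below′) with ℕ.<-cmp y z
... | tri≈ _ y≡z _ = y≡z
-- At the smaller of the two candidates `f` would return both 0 and a successor.
... | tri< y<z _ _ = contradiction (deterministic f (proj₂ (below′ y y<z))) λ ()
... | tri> _ _ z<y = contradiction (deterministic (proj₂ (below z z<y)) f′) λ ()

-- Enumeration of programs

vectors : ∀ {A : Set} → List A → ∀ m → List (Vec A m)
vectors xs zero    = [ [] ]
vectors xs (suc m) = cartesianProductWith _∷_ xs (vectors xs m)

constants : ∀ k → List (Program k)
constants 0 = [ zero ]
constants 1 = succ ∷ oracle ∷ []
constants _ = []

compositions : (∀ j → List (Program j)) → ∀ k m → List (Program k)
compositions P k m = cartesianProductWith comp (P m) (vectors (P k) m)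

recursions : (∀ j → List (Program j)) → ∀ k → List (Program k)
recursions P zero    = []
recursions P (suc k) = cartesianProductWith prec (P k) (P (2 ℕ.+ k))

-- The number d bounds both the nesting depth and the widths of compositions.
programs : ℕ → ∀ k → List (Program k)
programs zero    k = []
programs (suc d) k =
  constants k ++
  map proj (allFin k) ++
  concatMap (compositions (programs d) k) (upTo d) ++
  recursions (programs d) k ++
  map mu (programs d (suc k))

module _ (d : ℕ) {k : ℕ} where

  constant∈programs : ∀ {f} → f ∈ constants k → f ∈ programs (suc d) k
  constant∈programs = ∈-++⁺ˡ

  proj∈programs : ∀ i → proj i ∈ programs (suc d) k
  proj∈programs i = ∈-++⁺ʳ (constants k) (∈-++⁺ˡ (∈-map⁺ proj (∈-allFin i)))

  composition∈programs : ∀ {f m} → m ℕ.< d → f ∈ compositions (programs d) k m →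
    f ∈ programs (suc d) k
  composition∈programs m<d f∈ =
    ∈-++⁺ʳ (constants k) (∈-++⁺ʳ (map proj (allFin k)) (∈-++⁺ˡ
      (∈-concatMap⁺ (compositions (programs d) k) (lose (∈-upTo⁺ m<d) f∈))))

  recursion∈programs : ∀ {f} → f ∈ recursions (programs d) k → f ∈ programs (suc d) k
  recursion∈programs f∈ =
    ∈-++⁺ʳ (constants k) (∈-++⁺ʳ (map proj (allFin k)) (∈-++⁺ʳ
      (concatMap (compositions (programs d) k) (upTo d)) (∈-++⁺ˡ f∈)))

  mu∈programs : ∀ {f} → f ∈ programs d (suc k) → mu f ∈ programs (suc d) k
  mu∈programs f∈ =
    ∈-++⁺ʳ (constants k) (∈-++⁺ʳ (map proj (allFin k)) (∈-++⁺ʳ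
      (concatMap (compositions (programs d) k) (upTo d))
      (∈-++⁺ʳ (recursions (programs d) k) (∈-map⁺ mu f∈))))

mutual

  -- Once all immediate subprograms are listed at depth `d`, the program is listed at depth `suc d`.
  -- Argument vectors are treated by mutual recursion, so that their entries count as structurally
  -- smaller.
  eventually-∈programs : ∀ {k} (f : Program k) → Eventually (λ d → f ∈ programs d k)
  eventually-∈programs zero = eventually-suc (0 , λ d _ → constant∈programs d (here refl))
  eventually-∈programs succ = eventually-suc (0 , λ d _ → constant∈programs d (here refl))
  eventually-∈programs oracle =
    eventually-suc (0 , λ d _ → constant∈programs d (there (here refl)))
  eventually-∈programs (proj i) = eventually-suc (0 , λ d _ → proj∈programs d i)
  eventually-∈programs (comp {m = m} f gs) = eventually-suc (eventually-map
    (λ d (m<d , f∈ , gs∈) → composition∈programs d m<d (∈-cartesianProductWith⁺ comp f∈ gs∈))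
    -- Depth `suc d` lists only compositions of width below `d`.
    (eventually-× (suc m , λ _ m<d → m<d)
      (eventually-× (eventually-∈programs f) (eventually-∈vectors gs))))
  eventually-∈programs (prec f g) = eventually-suc (eventually-map
    (λ d (f∈ , g∈) → recursion∈programs d (∈-cartesianProductWith⁺ prec f∈ g∈))
    (eventually-× (eventually-∈programs f) (eventually-∈programs g)))
  eventually-∈programs (mu f) =
    eventually-suc (eventually-map (λ d → mu∈programs d) (eventually-∈programs f))

  eventually-∈vectors : ∀ {k m} (gs : Vec (Program k) m) →
    Eventually (λ d → gs ∈ vectors (programs d k) m)
  eventually-∈vectors []       = 0 , λ _ _ → here refl
  eventually-∈vectors (g ∷ gs) = eventually-map
    (λ _ (g∈ , gs∈) → ∈-cartesianProductWith⁺ _∷_ g∈ gs∈)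
    (eventually-× (eventually-∈programs g) (eventually-∈vectors gs))

-- Rational arithmetic

/-mono-≤ : ∀ a b c d .{{_ : NonZero b}} .{{_ : NonZero d}} →
  a ℕ.* d ℕ.≤ c ℕ.* b → + a / b ≤ + c / d
/-mono-≤ a (suc b) c (suc d) ad≤cb = ℚ.toℚᵘ-cancel-≤ (begin
  toℚᵘ (+ a / suc b)  ≃⟨ ℚ.toℚᵘ-fromℚᵘ (mkℚᵘ (+ a) b) ⟩
  mkℚᵘ (+ a) b        ≤⟨ *≤* (subst₂ ℤ._≤_ (ℤ.pos-* a (suc d)) (ℤ.pos-* c (suc b)) (ℤ.+≤+ ad≤cb)) ⟩
  mkℚᵘ (+ c) d        ≃⟨ ℚ.toℚᵘ-fromℚᵘ (mkℚᵘ (+ c) d) ⟨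
  toℚᵘ (+ c / suc d)  ∎)
  where
  open ℚᵘ.≤-Reasoning

1/-halve : ∀ n .{{_ : NonZero n}} .{{_ : NonZero (2 ℕ.* n)}} →
  1ℤ / (2 ℕ.* n) + 1ℤ / (2 ℕ.* n) ≡ 1ℤ / n
1/-halve n@(suc k) = ℚ.toℚᵘ-injective (begin-equality
  toℚᵘ (fromℚᵘ h + fromℚᵘ h)                 ≃⟨ ℚ.toℚᵘ-homo-+ (fromℚᵘ h) (fromℚᵘ h) ⟩
  toℚᵘ (fromℚᵘ h) ℚᵘ.+ toℚᵘ (fromℚᵘ h)       ≃⟨ ℚᵘ.+-cong (ℚ.toℚᵘ-fromℚᵘ h) (ℚ.toℚᵘ-fromℚᵘ h) ⟩
  h ℚᵘ.+ h                                   ≃⟨ *≡* (cong +_ (identity k)) ⟩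
  mkℚᵘ 1ℤ k                                  ≃⟨ ℚ.toℚᵘ-fromℚᵘ (mkℚᵘ 1ℤ k) ⟨
  toℚᵘ (fromℚᵘ (mkℚᵘ 1ℤ k))                  ∎)
  where
  open ℚᵘ.≤-Reasoning
  h = mkℚᵘ 1ℤ (k ℕ.+ suc (k ℕ.+ 0))
  identity : ∀ k → let n = suc k; m = n ℕ.+ (n ℕ.+ 0) in
    (m ℕ.+ 0 ℕ.+ (m ℕ.+ 0)) ℕ.* n ≡ m ℕ.* m ℕ.+ 0
  identity = solve-∀

2^-‿halve : ∀ l → 2^- suc l + 2^- suc l ≡ 2^- l
2^-‿halve l = 1/-halve (2 ^ l) {{ℕ.m^n≢0 2 l}} {{ℕ.m^n≢0 2 (suc l)}}

2^-‿pos : ∀ l → 0ℚ < 2^- l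
2^-‿pos l = ℚ.positive⁻¹ (2^- l) {{ℚ.normalize-pos 1 (2 ^ l) {{ℕ.m^n≢0 2 l}}}}

p≤∣p∣ : ∀ p → p ≤ ∣ p ∣
p≤∣p∣ p with ℚ.≤-total 0ℚ p
... | inj₁ 0≤p = ℚ.≤-reflexive (sym (ℚ.0≤p⇒∣p∣≡p 0≤p))
... | inj₂ p≤0 = ℚ.≤-trans p≤0 (ℚ.nonNegative⁻¹ ∣ p ∣ {{ℚ.∣-∣-nonNeg p}})

+-interchange : ∀ p q r s → (p + q) + (r + s) ≡ (p + r) + (q + s)
+-interchange = interchange (CommutativeMonoid.commutativeSemigroup ℚ.+-0-commutativeMonoid)

partialSum-+ : ∀ a b c → (∀ i → a i + b i ≡ c i + c i) →
  ∀ n → partialSum a n + partialSum b n ≡ partialSum c n + partialSum c n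
partialSum-+ a b c eq zero    = refl
partialSum-+ a b c eq (suc n) = trans
  (+-interchange (a 0) _ (b 0) _)
  (trans (cong₂ _+_ (eq 0) (partialSum-+ (a ∘ suc) (b ∘ suc) (c ∘ suc) (eq ∘ suc) n))
    (+-interchange (c 0) (c 0) _ _))

partialSum-nonNeg : ∀ {a} → (∀ i → 0ℚ ≤ a i) → ∀ n → 0ℚ ≤ partialSum a n
partialSum-nonNeg 0≤a zero    = ℚ.≤-refl
partialSum-nonNeg 0≤a (suc n) = ℚ.+-mono-≤ (0≤a 0) (partialSum-nonNeg (0≤a ∘ suc) n)

partialSum-mono-≤ : ∀ {a} → (∀ i → 0ℚ ≤ a i) → ∀ {m n} → m ℕ.≤ n → partialSum a m ≤ partialSum a n
partialSum-mono-≤ 0≤a {n = n} z≤n = partialSum-nonNeg 0≤a n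
partialSum-mono-≤ {a} 0≤a (s≤s m≤n) =
  ℚ.+-monoʳ-≤ (a 0) (partialSum-mono-≤ (0≤a ∘ suc) m≤n)

term≤partialSum : ∀ {a} → (∀ i → 0ℚ ≤ a i) → ∀ i → a i ≤ partialSum a (suc i)
term≤partialSum {a} 0≤a zero = ℚ.≤-reflexive (sym (ℚ.+-identityʳ (a 0)))
term≤partialSum {a} 0≤a (suc i) = begin
  a (suc i)                               ≤⟨ term≤partialSum (0≤a ∘ suc) i ⟩
  partialSum (a ∘ suc) (suc i)            ≡⟨ ℚ.+-identityˡ _ ⟨
  0ℚ + partialSum (a ∘ suc) (suc i)       ≤⟨ ℚ.+-monoˡ-≤ (partialSum (a ∘ suc) (suc i)) (0≤a 0) ⟩
  a 0 + partialSum (a ∘ suc) (suc i)      ∎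
  where open ℚ.≤-Reasoning

-- Covers of small measure

-- `nothing` stands for the empty set, which arises when a digit read contradicts the string of a
-- cylinder.
Cylinder : Set
Cylinder = Maybe Bitstring

⟦_⟧ : Cylinder → Pred Cantor 0ℓ
⟦ nothing ⟧ Z = ⊥
⟦ just σ  ⟧ Z = N σ Z

weight : Cylinder → ℚ
weight nothing  = 0ℚ
weight (just σ) = 2^- length σ

-- The set of tails `Z` with `b ∷ᶜ Z` in the cylinder; its weight is the conditional measure given
-- first digit `b`.
residual : Bool → Cylinder → Cylinder
residual b nothing                    = nothing
residual b (just [])                  = just []
residual false (just (false ∷ σ))     = just σ
residual false (just (true  ∷ σ))     = nothing
residual true  (just (false ∷ σ))     = nothing
residual true  (just (true  ∷ σ))     = just σ

residual-∷ : ∀ b σ → residual b (just (b ∷ σ)) ≡ just σ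
residual-∷ false σ = refl
residual-∷ true  σ = refl

weight-nonNeg : ∀ C → 0ℚ ≤ weight C
weight-nonNeg nothing  = ℚ.≤-refl
weight-nonNeg (just σ) = ℚ.<⇒≤ (2^-‿pos (length σ))

-- The two conditional measures average to the measure; the doubled form avoids division.
weight-residual : ∀ C → weight (residual false C) + weight (residual true C) ≡ weight C + weight C
weight-residual nothing            = refl
weight-residual (just [])          = refl
weight-residual (just (false ∷ σ)) =
  trans (ℚ.+-identityʳ _) (sym (2^-‿halve (length σ)))
weight-residual (just (true ∷ σ))  =
  trans (ℚ.+-identityˡ _) (sym (2^-‿halve (length σ)))

∈-residual : ∀ C Z → ⟦ C ⟧ Z → ⟦ residual (Z 0) C ⟧ (Z ∘ suc)
∈-residual (just [])      Z _  = refl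
∈-residual (just (b ∷ σ)) Z eq with refl , eq′ ← ∷-injective eq =
  subst (λ C → ⟦ C ⟧ (Z ∘ suc)) (sym (residual-∷ (Z 0) σ)) eq′

Family : Set
Family = ℕ → Cylinder

infixl 5 _∣_

_∣_ : Family → Bool → Family
(S ∣ b) i = residual b (S i)

Σ[_]≤_ : Family → ℚ → Set
Σ[ S ]≤ r = ∀ n → partialSum (weight ∘ S) n ≤ r

double-cancel-≤ : ∀ {p q r} → p + q ≤ r + r → r < p → q ≤ r
double-cancel-≤ {p} {q} {r} p+q≤r+r r<p = ℚ.≮⇒≥ λ r<q →
  ℚ.<-irrefl refl (ℚ.<-≤-trans (ℚ.+-mono-< r<p r<q) p+q≤r+r)

partialSum-residual : ∀ S n →
  partialSum (weight ∘ (S ∣ false)) n + partialSum (weight ∘ (S ∣ true)) n ≡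
  partialSum (weight ∘ S) n + partialSum (weight ∘ S) n
partialSum-residual S = partialSum-+ _ _ _ (weight-residual ∘ S)

residual-≤ : ∀ S {r} b → Σ[ S ]≤ r → Σ[ S ∣ b ]≤ (r + r)
residual-≤ S {r} b S≤r n = ℚ.≤-trans (bound b)
  (ℚ.≤-trans (ℚ.≤-reflexive (partialSum-residual S n)) (ℚ.+-mono-≤ (S≤r n) (S≤r n)))
  where
  s : Bool → ℚ
  s b = partialSum (weight ∘ (S ∣ b)) n
  0≤s : ∀ b → 0ℚ ≤ s b
  0≤s b = partialSum-nonNeg (weight-nonNeg ∘ (S ∣ b)) n
  bound : ∀ b → s b ≤ s false + s true
  bound false = ℚ.≤-trans (ℚ.≤-reflexive (sym (ℚ.+-identityʳ _))) (ℚ.+-monoʳ-≤ (s false) (0≤s true))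
  bound true  = ℚ.≤-trans (ℚ.≤-reflexive (sym (ℚ.+-identityˡ _))) (ℚ.+-monoˡ-≤ (s true) (0≤s false))

infixr 5 _∷ᶜ_

_∷ᶜ_ : Bool → Cantor → Cantor
(b ∷ᶜ Z) zero    = b
(b ∷ᶜ Z) (suc i) = Z i

module _ (em : ExcludedMiddle 0ℓ) where

  -- The conditional weights of the family average to at most `r`, so they cannot both exceed `r`.
  branch : ∀ S {r} → Σ[ S ]≤ r → ∃[ b ] Σ[ S ∣ b ]≤ r
  branch S {r} S≤r with em {Σ[ S ∣ false ]≤ r}
  ... | yes S0≤r = false , S0≤r
  ... | no  S0≰r with em {∃[ m ] r < partialSum (weight ∘ (S ∣ false)) m}
  ...   | no ¬big = contradiction (λ m → ℚ.≮⇒≥ λ r<s → ¬big (m , r<s)) S0≰r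
  -- Partial sums increase, so at `k` the `false` side still exceeds `r`. Hence the `true` side is
  -- at most `r` at `k`, and so at `n`.
  ...   | yes (m , r<s) = true , λ n → let k = m ⊔ n in
    ℚ.≤-trans (partialSum-mono-≤ (weight-nonNeg ∘ (S ∣ true)) (ℕ.m≤n⊔m m n))
      (double-cancel-≤
        (ℚ.≤-trans (ℚ.≤-reflexive (partialSum-residual S k)) (ℚ.+-mono-≤ (S≤r k) (S≤r k)))
        (ℚ.<-≤-trans r<s (partialSum-mono-≤ (weight-nonNeg ∘ (S ∣ false)) (ℕ.m≤m⊔n m n))))

  avoid : ∀ S {r} → Σ[ S ]≤ r → Cantor
  avoid S S≤r zero    = proj₁ (branch S S≤r)
  avoid S S≤r (suc i) = avoid (S ∣ proj₁ (branch S S≤r)) (proj₂ (branch S S≤r)) i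

  -- The bound `r` survives every digit. If the point began with `σ`, then after reading `σ` the
  -- family would contain the whole space, of weight 1.
  avoid-∉ : ∀ {S r} (S≤r : Σ[ S ]≤ r) → r < 1ℚ → ∀ σ i → S i ≡ just σ → ¬ N σ (avoid S S≤r)
  avoid-∉ {S} {r} S≤r r<1 [] i Si≡ _ = ℚ.<-irrefl refl (begin-strict
    1ℚ                              ≡⟨ cong weight Si≡ ⟨
    weight (S i)                    ≤⟨ term≤partialSum (weight-nonNeg ∘ S) i ⟩
    partialSum (weight ∘ S) (suc i) ≤⟨ S≤r (suc i) ⟩
    r                               <⟨ r<1 ⟩
    1ℚ                              ∎)
    where open ℚ.≤-Reasoning
  avoid-∉ {S} S≤r r<1 (b ∷ σ) i Si≡ ∈N with b≡ , ∈N′ ← ∷-injective ∈N =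
    avoid-∉ (proj₂ (branch S S≤r)) r<1 σ i
      (trans (cong₂ residual b≡ Si≡) (residual-∷ b σ)) ∈N′

  -- Copying a digit of `Y` at most doubles the weight. After `m` digits the bound is still below 1,
  -- and `avoid` chooses the rest.
  escape : ∀ m S {r} Y → Σ[ S ]≤ r → r < 2^- m → ∃[ Z ] Y ≈[ m ] Z × ∀ i → ¬ ⟦ S i ⟧ Z
  escape zero S Y S≤r r<1 = avoid S S≤r , (λ _ ()) , avoids
    where
    avoids : ∀ i → ¬ ⟦ S i ⟧ (avoid S S≤r)
    avoids i ∈S with S i in Si≡
    ... | just σ = avoid-∉ S≤r r<1 σ i Si≡ ∈S
  escape (suc m) S {r} Y S≤r r<
    with Z , Y≈Z , avoids ← escape m (S ∣ Y 0) (Y ∘ suc) (residual-≤ S (Y 0) S≤r)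
           (subst (r + r <_) (2^-‿halve m) (ℚ.+-mono-< r< r<)) =
    Y 0 ∷ᶜ Z ,
    (λ { zero _ → refl ; (suc i) (s≤s i<m) → Y≈Z i i<m }) ,
    (λ i ∈S → avoids i (∈-residual (S i) (Y 0 ∷ᶜ Z) ∈S))

-- Normality

occurrences-step : ∀ {X n} → X n ≡ false → occurrences X [ true ] (suc n) ≡ occurrences X [ true ] n
occurrences-step {X} {n} Xn≡ = cong length (begin
  filter ones? (upTo (suc n))               ≡⟨ cong (filter ones?) (upTo-∷ʳ n) ⟨
  filter ones? (upTo n ++ [ n ])            ≡⟨ filter-++ ones? (upTo n) [ n ] ⟩
  filter ones? (upTo n) ++ filter ones? [ n ] ≡⟨ cong (filter ones? (upTo n) ++_) (filter-reject ones? {xs = []} Xn≢) ⟩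
  filter ones? (upTo n) ++ []               ≡⟨ ++-identityʳ _ ⟩
  filter ones? (upTo n)                     ∎)
  where
  open ≡-Reasoning
  ones? = λ i → block X i 1 ≟ᵇ [ true ]
  Xn≢ : block X n 1 ≢ [ true ]
  Xn≢ eq with () ← trans (sym Xn≡) (trans (cong X (sym (ℕ.+-identityʳ n))) (proj₁ (∷-injective eq)))

occurrences-constant : ∀ {X a n} → a ≤′ n → (∀ i → a ℕ.≤ i → i ℕ.< n → X i ≡ false) →
  occurrences X [ true ] n ≡ occurrences X [ true ] a
occurrences-constant ≤′-refl _ = refl
occurrences-constant {X} {a} (≤′-step {n} a≤n) zeros = trans
  (occurrences-step {X} (zeros n (ℕ.≤′⇒≤ a≤n) ℕ.≤-refl))
  (occurrences-constant a≤n (λ i a≤i i<n → zeros i a≤i (ℕ.m<n⇒m<1+n i<n)))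

occurrences-≤ : ∀ X σ n → occurrences X σ n ℕ.≤ n
occurrences-≤ X σ n = ℕ.≤-trans (length-filter _ (upTo n)) (ℕ.≤-reflexive (length-upTo n))

-- Among the first `4a + 1` digits only the first `a` can be 1, so the frequency of 1 is at most
-- 1/4, at distance at least 1/4 from 1/2.
zeroBlocks⇒¬normal : ∀ {X} →
  (∀ n₀ → ∃[ a ] n₀ ℕ.≤ a × ∀ i → a ℕ.≤ i → i ℕ.< suc (4 ℕ.* a) → X i ≡ false) →
  ¬ Normal X
zeroBlocks⇒¬normal {X} blocks normal
  with n₀ , close ← normal [ true ] (1ℤ / 4) (ℚ.positive⁻¹ (1ℤ / 4))
  with a , n₀≤a , zeros ← blocks n₀ =
  ℚ.<-irrefl refl (begin-strict
    -- The left side is `- (1ℤ / 4 - ½)`, equal to 1/4 by computation.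
    1ℤ / 4                ≤⟨ ℚ.neg-antimono-≤ (ℚ.+-monoˡ-≤ (- ½) frequency≤¼) ⟩
    - (frequency X [ true ] n - ½)     ≤⟨ p≤∣p∣ _ ⟩
    ∣ - (frequency X [ true ] n - ½) ∣ ≡⟨ ℚ.∣-p∣≡∣p∣ (frequency X [ true ] n - ½) ⟩
    ∣ frequency X [ true ] n - ½ ∣     <⟨ close n (ℕ.≤-trans n₀≤a a≤n) ⟩
    1ℤ / 4                ∎)
  where
  open ℚ.≤-Reasoning
  n = suc (4 ℕ.* a)
  a≤n : a ℕ.≤ n
  a≤n = ℕ.m≤n⇒m≤1+n (ℕ.m≤n*m a 4)
  occurrences≤a : occurrences X [ true ] n ℕ.≤ a
  occurrences≤a = ℕ.≤-trans
    (ℕ.≤-reflexive (occurrences-constant (ℕ.≤⇒≤′ a≤n) zeros)) (occurrences-≤ X [ true ] a)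
  frequency≤¼ : frequency X [ true ] n ≤ 1ℤ / 4
  frequency≤¼ = /-mono-≤ (occurrences X [ true ] n) n 1 4 (ℕ.≤-trans
    (ℕ.*-monoˡ-≤ 4 occurrences≤a)
    (ℕ.≤-trans (ℕ.≤-reflexive (ℕ.*-comm a 4)) (ℕ.≤-trans (ℕ.n≤1+n _) (ℕ.≤-reflexive (sym (ℕ.*-identityˡ n))))))

-- The construction

-- (Y , m) represents the initial segment of Y of length m.
Condition : Set
Condition = Cantor × ℕ

infix 4 _⊑_ _⊏_

_⊑_ : Condition → Condition → Set
(Y , m) ⊑ (Z , n) = m ℕ.≤ n × Y ≈[ m ] Z

_⊏_ : Condition → Cantor → Set
(Y , m) ⊏ X = Y ≈[ m ] X

⊑-refl : ∀ {c} → c ⊑ c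
⊑-refl = ℕ.≤-refl , λ _ _ → refl

⊑-⊏-trans : ∀ {c d X} → c ⊑ d → d ⊏ X → c ⊏ X
⊑-⊏-trans (m≤n , Y≈Z) Z≈X i i<m = trans (Y≈Z i i<m) (Z≈X i (ℕ.<-≤-trans i<m m≤n))

⊑-trans : ∀ {c d e} → c ⊑ d → d ⊑ e → c ⊑ e
⊑-trans {d = d} c⊑d@(m≤n , _) (n≤k , Z≈W) = ℕ.≤-trans m≤n n≤k , ⊑-⊏-trans {d = d} c⊑d Z≈W

-- The added 1 makes the length grow strictly even from `m = 0`.
pad : Condition → Condition
pad (Y , m) = (λ i → if does (i ℕ.<? m) then Y i else false) , suc (4 ℕ.* m)

pad-⊒ : ∀ c → c ⊑ pad c
pad-⊒ (Y , m) = ℕ.m≤n⇒m≤1+n (ℕ.m≤n*m m 4) , agree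
  where
  agree : Y ≈[ m ] proj₁ (pad (Y , m))
  agree i i<m rewrite dec-true (i ℕ.<? m) i<m = refl

pad-false : ∀ Y m i → m ℕ.≤ i → proj₁ (pad (Y , m)) i ≡ false
pad-false Y m i m≤i rewrite dec-false (i ℕ.<? m) (ℕ.≤⇒≯ m≤i) = refl

-- If `f` decides the predicate defining a Π⁰₁ set, the whole neighbourhood given by `c` is disjoint
-- from that set, with one `n` as witness.
Forces : Program 1 → Condition → Set
Forces f c = ∃[ n ] (∀ X → c ⊏ X → X ⊢ f ⟨ n ∷ [] ⟩⇓ 0)

Forceable : Program 1 → Condition → Set
Forceable f c = ∃[ d ] c ⊑ d × Forces f d

module Construction (em : ExcludedMiddle 0ℓ) where

  meet : Program 1 → Condition → Condition
  meet f c with em {Forceable f c}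
  ... | yes (d , _) = d
  ... | no  _       = c

  meet-⊒ : ∀ f c → c ⊑ meet f c
  meet-⊒ f c with em {Forceable f c}
  ... | yes (_ , c⊑d , _) = c⊑d
  ... | no  _             = ⊑-refl

  meet-forces : ∀ f c → Forceable f c → Forces f (meet f c)
  meet-forces f c forceable with em {Forceable f c}
  ... | yes (_ , _ , forces) = forces
  ... | no ¬forceable        = contradiction forceable ¬forceable

  meetAll : List (Program 1) → Condition → Condition
  meetAll []       c = c
  meetAll (f ∷ fs) c = meetAll fs (meet f c)

  meetAll-⊒ : ∀ fs c → c ⊑ meetAll fs c
  meetAll-⊒ []       c = ⊑-refl
  meetAll-⊒ (f ∷ fs) c = ⊑-trans (meet-⊒ f c) (meetAll-⊒ fs (meet f c))

  -- The condition `d` reached when the turn of `f` comes depends on the programs before it; later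
  -- turns only extend the result.
  meetAll-∈ : ∀ {f fs} → f ∈ fs → ∀ c → ∃[ d ] meet f d ⊑ meetAll fs c
  meetAll-∈ {fs = f ∷ fs} (here refl) c = c , meetAll-⊒ fs (meet f c)
  meetAll-∈ {fs = g ∷ fs} (there f∈)  c = meetAll-∈ f∈ (meet g c)

  stage : ℕ → Condition
  stage zero    = (λ _ → false) , 0
  stage (suc s) = meetAll (programs s 1) (pad (stage s))

  stage-step : ∀ s → stage s ⊑ stage (suc s)
  stage-step s = ⊑-trans (pad-⊒ (stage s)) (meetAll-⊒ (programs s 1) (pad (stage s)))

  stage-mono : ∀ {s t} → s ≤′ t → stage s ⊑ stage t
  stage-mono ≤′-refl           = ⊑-refl
  stage-mono (≤′-step {t} s≤t) = ⊑-trans (stage-mono s≤t) (stage-step t)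

  stage-length : ∀ s → s ℕ.≤ proj₂ (stage s)
  stage-length zero    = z≤n
  stage-length (suc s) = begin
    suc s                                ≤⟨ s≤s (stage-length s) ⟩
    suc (proj₂ (stage s))                ≤⟨ s≤s (ℕ.m≤n*m _ 4) ⟩
    proj₂ (pad (stage s))                ≤⟨ proj₁ (meetAll-⊒ (programs s 1) (pad (stage s))) ⟩
    proj₂ (stage (suc s))                ∎
    where open ℕ.≤-Reasoning

  -- Stage `suc i` has length at least `suc i`, so its digit `i` is final.
  limit : Cantor
  limit i = proj₁ (stage (suc i)) i

  stage-⊏ : ∀ s → stage s ⊏ limit
  stage-⊏ s i i<m with ℕ.≤-total s (suc i)
  ... | inj₁ s≤1+i = proj₂ (stage-mono (ℕ.≤⇒≤′ s≤1+i)) i i<m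
  ... | inj₂ 1+i≤s = sym (proj₂ (stage-mono (ℕ.≤⇒≤′ 1+i≤s)) i (stage-length (suc i)))

  limit-¬normal : ¬ Normal limit
  limit-¬normal = zeroBlocks⇒¬normal λ s → proj₂ (stage s) , stage-length s , λ i m≤i i<n →
    trans (sym (⊑-⊏-trans {d = stage (suc s)}
             (meetAll-⊒ (programs s 1) (pad (stage s))) (stage-⊏ (suc s)) i i<n))
      (pad-false (proj₁ (stage s)) (proj₂ (stage s)) i m≤i)

  -- A cover of weight below `2^- m` misses some `Z` extending `c`. Without a forcing extension `f`
  -- never answers 0 at `Z`, which puts `Z` in `A` and hence in the cover.
  null⇒forceable : ∀ {A} ((R , (f , _) , _) : Π⁰₁ A) → HasMeasure A 0ℚ → ∀ c → Forceable f c
  null⇒forceable (R , (f , decides) , A⇔) null c@(Y , m)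
    with σ , A⊆⋃ , r , r<2^-m , Σ≤r ← Equivalence.from (null (2^- m)) (2^-‿pos m)
    with Z , Y≈Z , Z∉ ← escape em m (just ∘ σ) Y Σ≤r r<2^-m
    with em {Forceable f c}
  ... | yes forceable  = forceable
  ... | no ¬forceable = contradiction (A⊆⋃ (Equivalence.from (A⇔ Z) R-holds)) λ (i , Z∈) → Z∉ i Z∈
    where
    R-holds : ∀ n → R Z n
    R-holds n with decides Z n
    ... | inj₁ (Rn , _) = Rn
    ... | inj₂ (_ , ⇓0) = contradiction
      -- Long enough both to extend `c` and to contain the use of the computation.
      ((Z , m ⊔ proj₁ (use ⇓0)) ,
       (ℕ.m≤m⊔n m _ , Y≈Z) ,
       n , proj₂ (use ⇓0) _ (ℕ.m≤n⊔m m _))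
      ¬forceable

  limit-weaklyRandom : WeaklyRandom limit
  limit-weaklyRandom A Π@(R , (f , decides) , A⇔) null limit∈A
    with s , f∈ ← eventually-∈programs f
    with d , d⊑ ← meetAll-∈ (f∈ s ℕ.≤-refl) (pad (stage s))
    -- Forceability holds at every condition, so in particular at the unknown `d`.
    with n , forced ← meet-forces f d (null⇒forceable Π null d)
    with decides limit n
  ... | inj₂ (¬Rn , _) = ¬Rn (Equivalence.to (A⇔ limit) limit∈A n)
  ... | inj₁ (_ , ⇓1)  = contradiction
    (deterministic ⇓1 (forced limit (⊑-⊏-trans {d = stage (suc s)} d⊑ (stage-⊏ (suc s))))) λ ()

mainTheorem4 : ExcludedMiddle 0ℓ → Σ[ X ∈ Cantor ] (WeaklyRandom X × ¬ Normal X)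
mainTheorem4 em = limit , limit-weaklyRandom , limit-¬normal
  where open Construction em
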